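{- Let $\Gamma\Rightarrow\Delta$ be a sequent. (1) If $\mathsf{G}^c(\mathbf{K}_D)\vdash\Gamma\Rightarrow\Delta$ then $\Gamma\Rightarrow\Delta$ is valid in the class $\mathbb{M}$ of all models. (2) If $\mathsf{G}^c(\mathbf{KD}_D)\vdash\Gamma\Rightarrow\Delta$ then $\Gamma\Rightarrow\Delta$ is valid in $\mathbb{M}_{\mathbf{ser}}$. (3) If $\mathsf{G}^c(\mathbf{KT}_D)\vdash\Gamma\Rightarrow\Delta$ then $\Gamma\Rightarrow\Delta$ is valid in $\mathbb{M}_{\mathbf{ref}}$.
   Context: Language: fix a finite nonempty set $\mathsf{Agt}$ of agents and a countable set $\mathsf{Prop}$ of propositional variables; $\mathsf{Grp}$ is the set of nonempty subsets of $\mathsf{Agt}$. Formulas: $\alpha::=p\mid\bot\mid\alpha\wedge\alpha\mid\alpha\vee\alpha\mid\alpha\rightarrow\alpha\mid\neg\alpha\mid D_G\alpha$ ($p\in\mathsf{Prop}$, $G\in\mathsf{Grp}$). Outmost-boxed formula: one of the form $D_G\gamma$. Semantics: a model $M=(W,(R_G)_{G\in\mathsf{Grp}},V)$ has a set $W$ of states, binary relations $R_G\subseteq W\times W$ with $R_H\subseteq R_G$ whenever $G\subseteq H$, and $V:\mathsf{Prop}\to\mathcal P(W)$. Truth is classical for connectives and $M,w\models D_G\alpha$ iff $M,v\models\alpha$ for all $v$ with $(w,v)\in R_G$. $\mathbb{M}$ is the class of all models; $\mathbb{M}_{\mathbf{ser}}$ the class of models where $R_{\{a\}}$ is serial for every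 $a\in\mathsf{Agt}$; $\mathbb{M}_{\mathbf{ref}}$ the class where every $R_G$ is reflexive. A sequent $\Gamma\Rightarrow\Delta$ is valid in a class of models if $\bigwedge\Gamma\rightarrow\bigvee\Delta$ is true at every state of every model of the class (empty conjunction is $\top$, empty disjunction is $\bot$). Sequent calculi (sequents $\Gamma\Rightarrow\Delta$ are pairs of finite multisets; derivable = root of a finite tree built from initial sequents by rules): $\mathsf{G}(\mathbf{K}_D)$ has initial sequents $\Gamma,p\Rightarrow p,\Delta$ and $\bot,\Gamma\Rightarrow\Delta$; rules $(R\wedge)$ from $\Gamma\Rightarrow\Delta,\alpha_1$ and $\Gamma\Rightarrow\Delta,\alpha_2$ infer $\Gamma\Rightarrow\Delta,\alpha_1\wedge\alpha_2$; $(L\wedge)$ from $\alpha_1,\alpha_2,\Gamma\Rightarrow\Delta$ infer $\alpha_1\wedge\alpha_2,\Gamma\Rightarrow\Delta$; $(R\vee)$ from $\Gamma\Rightarrow\Delta,\alpha_1,\alpha_2$ infer $\Gamma\Rightarrow\Delta,\alpha_1\vee\alpha_2$; $(L\vee)$ from $\alpha_1,\Gamma\Rightarrow\Delta$ and $\alpha_2,\Gamma\Rightarrow\Delta$ infer $\alpha_1\vee\alpha_2,\Gamma\Rightarrow\Delta$; $(R\rightarrow)$ from $\alpha_1,\Gamma\Rightarrow\Delta,\alpha_2$ infer $\Gamma\Rightarrow\Delta,\alpha_1\rightarrow\alpha_2$; $(L\rightarrow)$ from $\Gamma\Rightarrow\Delta,\alpha_1$ and $\alpha_2,\Gamma\Rightarrow\Delta$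 infer $\alpha_1\rightarrow\alpha_2,\Gamma\Rightarrow\Delta$; $(R\neg)$ from $\alpha,\Gamma\Rightarrow\Delta$ infer $\Gamma\Rightarrow\Delta,\neg\alpha$; $(L\neg)$ from $\Gamma\Rightarrow\Delta,\alpha$ infer $\neg\alpha,\Gamma\Rightarrow\Delta$; $(D_K)$: from $\alpha_1,\dots,\alpha_n\Rightarrow\beta$ ($n\ge0$) infer $\Sigma,D_{G_1}\alpha_1,\dots,D_{G_n}\alpha_n\Rightarrow D_G\beta,\Omega$ where all $G_i\subseteq G$, $\Sigma$ consists only of propositional variables, $\bot$, and $D_H\gamma$ with $H\not\subseteq G$, and $\Omega$ only of propositional variables, $\bot$, outmost-boxed formulas. $\mathsf{G}(\mathbf{KD}_D)$ adds $(D_D)$: from $\Gamma\Rightarrow$ with $\Gamma\neq\emptyset$ infer $\Sigma,D_{\{a\}}\Gamma\Rightarrow\Omega$, $\Sigma$ only propositional variables, $\bot$, $D_H\gamma$ with $H\neq\{a\}$; $\Omega$ only propositional variables, $\bot$, outmost-boxed formulas. $\mathsf{G}(\mathbf{KT}_D)$ adds to $\mathsf{G}(\mathbf{K}_D)$ $(D_T)$: from $D_G\alpha,\alpha,\Gamma\Rightarrow\Delta$ infer $D_G\alpha,\Gamma\Rightarrow\Delta$. $\mathsf{G}^c(\mathbf{L})$ is $\mathsf{G}(\mathbf{L})$ plus the cut rule: from $\Gamma\Rightarrow\Delta,C$ and $C,\Gamma'\Rightarrow\Delta'$ infer $\Gamma,\Gamma'\Rightarrow\Delta,\Delta'$. 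-}

module Defs where

open import Data.Empty.Polymorphic using () renaming (⊥ to Falsum)
open import Data.Fin.Base using (Fin)
open import Data.Fin.Subset using (Subset; Nonempty; ⁅_⁆) renaming (_⊆_ to _⊆ˢ_)
open import Data.Fin.Subset.Properties using (x∈⁅x⁆)
open import Data.List.Base using (List; []; _∷_; _++_; map; foldr)
open import Data.List.Relation.Binary.Permutation.Propositional using (_↭_)
open import Data.List.Relation.Unary.All using (All)
open import Data.Nat.Base using (ℕ; NonZero)
open import Data.Product.Base using (∃; _×_; _,_; proj₁; proj₂; uncurry)
open import Data.Sum.Base using (_⊎_)
open import Data.Unit.Polymorphic using (⊤)
open import Function.Bundles using (_↣_)
open import Level using (Level) renaming (suc to lsuc)
open import Relation.Binary.Core using (Rel; _⇒_)
open import Relation.Binary.Definitions using (Reflexive)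
open import Relation.Binary.PropositionalEquality using (_≡_; _≢_)
open import Relation.Nullary.Negation using (¬_)
open import Relation.Unary using (Pred)

-- The finite nonempty set of agents is Fin numAgents; "countable" means
-- finite or countably infinite, i.e. embeddable in ℕ.
record Language : Set₁ where
  field
    numAgents   : ℕ
    ⦃ nonZero ⦄ : NonZero numAgents
    PropVar     : Set
    countable   : PropVar ↣ ℕ

  Agt : Set
  Agt = Fin numAgents

-- Nonemptiness is irrelevant, so that a group is determined by its members.
record Grp (L : Language) : Set where
  constructor group
  field
    members   : Subset (Language.numAgents L)
    .nonempty : Nonempty members

infix 4 _⊆_ _⊈_

_⊆_ : {L : Language} → Grp L → Grp L → Set
G ⊆ H = Grp.members G ⊆ˢ Grp.members H

_⊈_ : {L : Language} → Grp L → Grp L → Set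
G ⊈ H = ¬ (G ⊆ H)

｛_｝ : {L : Language} → Language.Agt L → Grp L
｛ a ｝ = group ⁅ a ⁆ (a , x∈⁅x⁆ a)

infixr 7 _∧ᶠ_
infixr 6 _∨ᶠ_
infixr 5 _→ᶠ_
infix  8 ¬ᶠ_

data Formula (L : Language) : Set where
  var            : Language.PropVar L → Formula L
  ⊥ᶠ             : Formula L
  _∧ᶠ_ _∨ᶠ_ _→ᶠ_ : Formula L → Formula L → Formula L
  ¬ᶠ_            : Formula L → Formula L
  D              : Grp L → Formula L → Formula L

-- ⊤ is not primitive in the language.
⊤ᶠ : {L : Language} → Formula L
⊤ᶠ = ¬ᶠ ⊥ᶠ

⋀ : {L : Language} → List (Formula L) → Formula L
⋀ = foldr _∧ᶠ_ ⊤ᶠ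

⋁ : {L : Language} → List (Formula L) → Formula L
⋁ = foldr _∨ᶠ_ ⊥ᶠ

record Model (L : Language) (ℓ : Level) : Set (lsuc ℓ) where
  field
    W          : Set ℓ
    R          : Grp L → Rel W ℓ
    R-antimono : {G H : Grp L} → G ⊆ H → R H ⇒ R G
    V          : Language.PropVar L → Pred W ℓ

infix 4 _,_⊨_

-- The clauses are the classical ones; they behave classically in the presence
-- of excluded middle for the ambient universe.
_,_⊨_ : {L : Language} {ℓ : Level} (M : Model L ℓ) → Model.W M → Formula L → Set ℓ
M , w ⊨ var p  = Model.V M p w
M , w ⊨ ⊥ᶠ     = Falsum
M , w ⊨ α ∧ᶠ β = (M , w ⊨ α) × (M , w ⊨ β)
M , w ⊨ α ∨ᶠ β = (M , w ⊨ α) ⊎ (M , w ⊨ β)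
M , w ⊨ α →ᶠ β = M , w ⊨ α → M , w ⊨ β
M , w ⊨ ¬ᶠ α   = ¬ (M , w ⊨ α)
M , w ⊨ D G α  = ∀ v → Model.R M G w v → M , v ⊨ α

ModelClass : Language → (ℓ : Level) → Set (lsuc ℓ)
ModelClass L ℓ = Model L ℓ → Set ℓ

𝕄 : {L : Language} {ℓ : Level} → ModelClass L ℓ
𝕄 M = ⊤

𝕄ser : {L : Language} {ℓ : Level} → ModelClass L ℓ
𝕄ser {L} M = (a : Language.Agt L) (w : Model.W M) → ∃ λ v → Model.R M ｛ a ｝ w v

𝕄ref : {L : Language} {ℓ : Level} → ModelClass L ℓ
𝕄ref {L} M = (G : Grp L) → Reflexive (Model.R M G)

ValidIn : {L : Language} {ℓ : Level} → ModelClass L ℓ → List (Formula L) → List (Formula L) → Set (lsuc ℓ)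
ValidIn {L} {ℓ} C Γ Δ = (M : Model L ℓ) → C M → (w : Model.W M) → M , w ⊨ ⋀ Γ →ᶠ ⋁ Δ

data Logic : Set where
  𝐊D 𝐊𝐃D 𝐊𝐓D : Logic

-- Propositional variables, ⊥, and boxed formulas D_H γ with P H.
data Context {L : Language} (P : Grp L → Set) : Formula L → Set where
  var : ∀ p → Context P (var p)
  bot : Context P ⊥ᶠ
  box : ∀ {H} γ → P H → Context P (D H γ)

infix 3 Gᶜ_⊢_⇒_

-- Multisets are lists up to permutation: the constructor perm identifies the
-- lists that represent the same multiset.
data Gᶜ_⊢_⇒_ {L : Language} (𝐋 : Logic) : List (Formula L) → List (Formula L) → Set where
  perm : ∀ {Γ Γ′ Δ Δ′} → Γ ↭ Γ′ → Δ ↭ Δ′ → Gᶜ 𝐋 ⊢ Γ ⇒ Δ → Gᶜ 𝐋 ⊢ Γ′ ⇒ Δ′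

  init : ∀ {Γ Δ p} → Gᶜ 𝐋 ⊢ var p ∷ Γ ⇒ var p ∷ Δ
  L⊥   : ∀ {Γ Δ} → Gᶜ 𝐋 ⊢ ⊥ᶠ ∷ Γ ⇒ Δ

  R∧ : ∀ {Γ Δ α₁ α₂} → Gᶜ 𝐋 ⊢ Γ ⇒ α₁ ∷ Δ → Gᶜ 𝐋 ⊢ Γ ⇒ α₂ ∷ Δ → Gᶜ 𝐋 ⊢ Γ ⇒ α₁ ∧ᶠ α₂ ∷ Δ
  L∧ : ∀ {Γ Δ α₁ α₂} → Gᶜ 𝐋 ⊢ α₁ ∷ α₂ ∷ Γ ⇒ Δ → Gᶜ 𝐋 ⊢ α₁ ∧ᶠ α₂ ∷ Γ ⇒ Δ
  R∨ : ∀ {Γ Δ α₁ α₂} → Gᶜ 𝐋 ⊢ Γ ⇒ α₁ ∷ α₂ ∷ Δ → Gᶜ 𝐋 ⊢ Γ ⇒ α₁ ∨ᶠ α₂ ∷ Δ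
  L∨ : ∀ {Γ Δ α₁ α₂} → Gᶜ 𝐋 ⊢ α₁ ∷ Γ ⇒ Δ → Gᶜ 𝐋 ⊢ α₂ ∷ Γ ⇒ Δ → Gᶜ 𝐋 ⊢ α₁ ∨ᶠ α₂ ∷ Γ ⇒ Δ
  R→ : ∀ {Γ Δ α₁ α₂} → Gᶜ 𝐋 ⊢ α₁ ∷ Γ ⇒ α₂ ∷ Δ → Gᶜ 𝐋 ⊢ Γ ⇒ (α₁ →ᶠ α₂) ∷ Δ
  L→ : ∀ {Γ Δ α₁ α₂} → Gᶜ 𝐋 ⊢ Γ ⇒ α₁ ∷ Δ → Gᶜ 𝐋 ⊢ α₂ ∷ Γ ⇒ Δ → Gᶜ 𝐋 ⊢ (α₁ →ᶠ α₂) ∷ Γ ⇒ Δ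
  R¬ : ∀ {Γ Δ α} → Gᶜ 𝐋 ⊢ α ∷ Γ ⇒ Δ → Gᶜ 𝐋 ⊢ Γ ⇒ ¬ᶠ α ∷ Δ
  L¬ : ∀ {Γ Δ α} → Gᶜ 𝐋 ⊢ Γ ⇒ α ∷ Δ → Gᶜ 𝐋 ⊢ ¬ᶠ α ∷ Γ ⇒ Δ

  -- The list Gαs holds the pairs (G₁ , α₁), …, (Gₙ , αₙ).
  D-K : ∀ {Σ Ω G β} (Gαs : List (Grp L × Formula L)) →
        All (λ Gα → proj₁ Gα ⊆ G) Gαs →
        All (Context (λ H → H ⊈ G)) Σ →
        All (Context (λ _ → ⊤)) Ω →
        Gᶜ 𝐋 ⊢ map proj₂ Gαs ⇒ β ∷ [] →
        Gᶜ 𝐋 ⊢ Σ ++ map (uncurry D) Gαs ⇒ D G β ∷ Ω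

  D-D : ∀ {Γ Σ Ω a} → 𝐋 ≡ 𝐊𝐃D →
        Γ ≢ [] →
        All (Context (λ H → H ≢ ｛ a ｝)) Σ →
        All (Context (λ _ → ⊤)) Ω →
        Gᶜ 𝐋 ⊢ Γ ⇒ [] →
        Gᶜ 𝐋 ⊢ Σ ++ map (D ｛ a ｝) Γ ⇒ Ω

  D-T : ∀ {Γ Δ G α} → 𝐋 ≡ 𝐊𝐓D →
        Gᶜ 𝐋 ⊢ D G α ∷ α ∷ Γ ⇒ Δ →
        Gᶜ 𝐋 ⊢ D G α ∷ Γ ⇒ Δ

  cut : ∀ {Γ Γ′ Δ Δ′} C → Gᶜ 𝐋 ⊢ Γ ⇒ C ∷ Δ → Gᶜ 𝐋 ⊢ C ∷ Γ′ ⇒ Δ′ → Gᶜ 𝐋 ⊢ Γ ++ Γ′ ⇒ Δ ++ Δ′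

{-# OPTIONS --safe #-}
module Submission where

open import Defs
open import Axiom.ExcludedMiddle using (ExcludedMiddle)
open import Data.Empty.Polymorphic using (⊥-elim)
open import Data.List.Base using (List; []; _∷_; map)
open import Data.List.Relation.Binary.Permutation.Propositional using (↭-sym)
open import Data.List.Relation.Binary.Permutation.Propositional.Properties using (All-resp-↭; Any-resp-↭)
open import Data.List.Relation.Unary.All using (All; []; _∷_)
open import Data.List.Relation.Unary.All.Properties using (++⁻ˡ; ++⁻ʳ)
open import Data.List.Relation.Unary.Any using (Any; here; there)
open import Data.List.Relation.Unary.Any.Properties using (++⁺ˡ; ++⁺ʳ; singleton⁻)
open import Data.Product.Base using (_×_; _,_; proj₁; proj₂; uncurry)
open import Data.Sum.Base using (inj₁; inj₂)
open import Level using (Level)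
open import Relation.Binary.PropositionalEquality using (refl)
open import Relation.Nullary.Decidable using (yes; no)
open import Relation.Nullary.Negation using (contradiction)

-- Fix a model in the class of the logic and induct on the derivation: every rule preserves the
-- property that, at each state where all antecedent formulas are true, some succedent formula is
-- true. The propositional rules and cut are truth-table reasoning at a single state. `D-K` and
-- `D-D` evaluate their premise at a successor; `unbox-⊆` and `unbox` carry the boxed antecedents
-- there. Seriality supplies the successor for `D-D`, and reflexivity justifies `D-T`.

module _ {L : Language} {ℓ : Level} (M : Model L ℓ) where
  open Model M

  ⊨⋀⇒All : ∀ {w} Γ → M , w ⊨ ⋀ Γ → All (M , w ⊨_) Γ
  ⊨⋀⇒All []      _         = []
  ⊨⋀⇒All (_ ∷ Γ) (⊨α , ⊨Γ) = ⊨α ∷ ⊨⋀⇒All Γ ⊨Γ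

  Any⇒⊨⋁ : ∀ {w Δ} → Any (M , w ⊨_) Δ → M , w ⊨ ⋁ Δ
  Any⇒⊨⋁ (here ⊨α)  = inj₁ ⊨α
  Any⇒⊨⋁ (there ⊨Δ) = inj₂ (Any⇒⊨⋁ ⊨Δ)

  -- Enlarging a group shrinks its relation, so a `G`-successor is also a successor for every
  -- subgroup of `G`, and each box with such an index can be instantiated at it.
  unbox-⊆ : ∀ {G w v} (Gαs : List (Grp L × Formula L)) → All (λ Gα → proj₁ Gα ⊆ G) Gαs →
            R G w v → All (M , w ⊨_) (map (uncurry D) Gαs) → All (M , v ⊨_) (map proj₂ Gαs)
  unbox-⊆ []        []         _   []         = []
  unbox-⊆ (_ ∷ Gαs) (G⊆ ∷ Gs⊆) wRv (⊨D ∷ ⊨Ds) =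
    ⊨D _ (R-antimono G⊆ wRv) ∷ unbox-⊆ Gαs Gs⊆ wRv ⊨Ds

  unbox : ∀ {G w v} Γ → R G w v → All (M , w ⊨_) (map (D G) Γ) → All (M , v ⊨_) Γ
  unbox []      _   []         = []
  unbox (_ ∷ Γ) wRv (⊨D ∷ ⊨Ds) = ⊨D _ wRv ∷ unbox Γ wRv ⊨Ds

-- Indexing the class by the logic lets one induction serve all three systems: matching the equation
-- stored in `D-D` or `D-T` turns class membership into seriality or reflexivity.
⟦_⟧ : Logic → {L : Language} {ℓ : Level} → ModelClass L ℓ
⟦ 𝐊D ⟧  = 𝕄
⟦ 𝐊𝐃D ⟧ = 𝕄ser
⟦ 𝐊𝐓D ⟧ = 𝕄ref

module _ {ℓ : Level} (em : ExcludedMiddle ℓ) {L : Language} {𝐋 : Logic}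
         (M : Model L ℓ) (M∈ : ⟦ 𝐋 ⟧ M) where

  -- `All` and `Any` stand in for `⋀` and `⋁` because they transport along permutations and split
  -- along `++`. The state is quantified after the derivation, so that the induction hypothesis
  -- applies at successors too.
  sound : ∀ {Γ Δ} → Gᶜ 𝐋 ⊢ Γ ⇒ Δ → ∀ {w} → All (M , w ⊨_) Γ → Any (M , w ⊨_) Δ
  sound (perm Γ↭ Δ↭ d) ⊨Γ = Any-resp-↭ Δ↭ (sound d (All-resp-↭ (↭-sym Γ↭) ⊨Γ))
  sound init (⊨p ∷ _) = here ⊨p
  sound L⊥ (⊨⊥ ∷ _) = ⊥-elim ⊨⊥
  sound (R∧ d₁ d₂) ⊨Γ with sound d₁ ⊨Γ | sound d₂ ⊨Γ
  ... | here ⊨α₁ | here ⊨α₂ = here (⊨α₁ , ⊨α₂)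
  ... | there ⊨Δ | _        = there ⊨Δ
  ... | here _   | there ⊨Δ = there ⊨Δ
  sound (L∧ d) ((⊨α₁ , ⊨α₂) ∷ ⊨Γ) = sound d (⊨α₁ ∷ ⊨α₂ ∷ ⊨Γ)
  sound (R∨ d) ⊨Γ with sound d ⊨Γ
  ... | here ⊨α₁         = here (inj₁ ⊨α₁)
  ... | there (here ⊨α₂) = here (inj₂ ⊨α₂)
  ... | there (there ⊨Δ) = there ⊨Δ
  sound (L∨ d₁ d₂) (inj₁ ⊨α₁ ∷ ⊨Γ) = sound d₁ (⊨α₁ ∷ ⊨Γ)
  sound (L∨ d₁ d₂) (inj₂ ⊨α₂ ∷ ⊨Γ) = sound d₂ (⊨α₂ ∷ ⊨Γ)
  -- A witness in the succedent must be chosen before any proof of `α₁` is given, so the truth of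
  -- `α₁` is decided classically; likewise for `R¬`.
  sound (R→ {α₁ = α₁} d) {w} ⊨Γ with em {M , w ⊨ α₁}
  ... | no ⊭α₁ = here λ ⊨α₁ → contradiction ⊨α₁ ⊭α₁
  ... | yes ⊨α₁ with sound d (⊨α₁ ∷ ⊨Γ)
  ...   | here ⊨α₂ = here λ _ → ⊨α₂
  ...   | there ⊨Δ = there ⊨Δ
  sound (L→ d₁ d₂) (⊨→ ∷ ⊨Γ) with sound d₁ ⊨Γ
  ... | here ⊨α₁ = sound d₂ (⊨→ ⊨α₁ ∷ ⊨Γ)
  ... | there ⊨Δ = ⊨Δ
  sound (R¬ {α = α} d) {w} ⊨Γ with em {M , w ⊨ α}
  ... | yes ⊨α = there (sound d (⊨α ∷ ⊨Γ))
  ... | no ⊭α  = here ⊭α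
  sound (L¬ d) (⊭α ∷ ⊨Γ) with sound d ⊨Γ
  ... | here ⊨α  = contradiction ⊨α ⊭α
  ... | there ⊨Δ = ⊨Δ
  sound (D-K {Σ = Σ} Gαs Gs⊆ _ _ d) ⊨Γ = here λ v wRv →
    singleton⁻ (sound d (unbox-⊆ M Gαs Gs⊆ wRv (++⁻ʳ Σ ⊨Γ)))
  -- At the successor given by seriality all of `Γ` would hold, yet the premise has an empty
  -- succedent: the antecedent cannot be true at `w`.
  sound (D-D {Γ = Γ} {Σ = Σ} {a = a} refl _ _ _ d) {w} ⊨Γ
    with v , wRv ← M∈ a w
    with () ← sound d (unbox M Γ wRv (++⁻ʳ Σ ⊨Γ))
  -- By reflexivity the state is its own successor, so the box yields its body there.
  sound (D-T {G = G} refl d) (⊨D ∷ ⊨Γ) = sound d (⊨D ∷ ⊨D _ (M∈ G) ∷ ⊨Γ)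
  sound (cut {Γ = Γ} {Δ = Δ} C d₁ d₂) ⊨Γ with sound d₁ (++⁻ˡ Γ ⊨Γ)
  ... | here ⊨C  = ++⁺ʳ Δ (sound d₂ (⊨C ∷ ++⁻ʳ Γ ⊨Γ))
  ... | there ⊨Δ = ++⁺ˡ ⊨Δ

soundness : {ℓ : Level} → ExcludedMiddle ℓ → {L : Language} (𝐋 : Logic) {Γ Δ : List (Formula L)} →
            Gᶜ 𝐋 ⊢ Γ ⇒ Δ → ValidIn {L} {ℓ} ⟦ 𝐋 ⟧ Γ Δ
soundness em 𝐋 {Γ} d M M∈ w ⊨⋀Γ = Any⇒⊨⋁ M (sound em {𝐋 = 𝐋} M M∈ d (⊨⋀⇒All M Γ ⊨⋀Γ))

theorem4p1 : {ℓ : Level} → ExcludedMiddle ℓ →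
    (L : Language) (Γ Δ : List (Formula L)) →
    ((Gᶜ 𝐊D ⊢ Γ ⇒ Δ) → ValidIn {L} {ℓ} 𝕄 Γ Δ)
    × ((Gᶜ 𝐊𝐃D ⊢ Γ ⇒ Δ) → ValidIn {L} {ℓ} 𝕄ser Γ Δ)
    × ((Gᶜ 𝐊𝐓D ⊢ Γ ⇒ Δ) → ValidIn {L} {ℓ} 𝕄ref Γ Δ)
theorem4p1 em L Γ Δ = soundness em 𝐊D , soundness em 𝐊𝐃D , soundness em 𝐊𝐓D
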